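{- For any integer $\Delta\ge 3$, there exists an isolate-free graph $G$ with maximum degree $\Delta(G)=\Delta$ such that $$TC(G)\ge \begin{cases}\frac{\Delta^2}{4}+\Delta+\frac{3}{4} & \text{if } \Delta \text{ is odd},\\[2pt] \frac{\Delta^2}{4}+\Delta+1 & \text{if } \Delta\text{ is even.}\end{cases}$$
   Context: All graphs are finite and simple (no loops or multiple edges). A graph is isolate-free if it has no vertex of degree $0$. A set $T\subseteq V$ of vertices of a graph $G(V,E)$ is a total dominating set if every vertex of $V$ is adjacent to at least one vertex of $T$. Two disjoint sets $A,B\subset V$ form a total coalition if neither $A$ nor $B$ is a total dominating set, but $A\cup B$ is. A total coalition partition of $G$ is a partition $\Psi=\{C_1,\dots,C_k\}$ of $V$ into non-empty classes such that for every $i$ there exists $j\neq i$ such that $C_i$ and $C_j$ form a total coalition. The total coalition number $TC(G)$ of an isolate-free graph $G$ is the maximum cardinality (number of classes) of a total coalition partition of $G$. -}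

module Defs where

open import Data.Fin.Base using (Fin)
open import Data.Fin.Subset using (Subset; _∈_; _∩_; _∪_; ∣_∣; Empty; Nonempty)
open import Data.Integer.Base using (+_)
open import Data.Nat.Base using (ℕ; _≤_; _⊔_; _^_; parity)
open import Data.Parity.Base using (0ℙ; 1ℙ)
open import Data.Product.Base using (∃; _×_)
open import Data.Rational.Base using (ℚ; _/_; _+_)
open import Data.Vec.Base using (tabulate)
open import Data.Vec.Functional using (Vector; foldr)
open import Level using (0ℓ)
open import Relation.Binary.Core using (Rel)
open import Relation.Binary.Definitions using (Decidable; Symmetric; Irreflexive)
open import Relation.Binary.PropositionalEquality.Core using (_≡_; _≢_)
open import Relation.Nullary.Decidable.Core using (does)
open import Relation.Nullary.Negation.Core using (¬_)

-- Finite simple graphs.  Decidability of adjacency is what finiteness gives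
-- classically, and is needed to count neighbours.
record Graph : Set₁ where
  field
    order  : ℕ
    _~_    : Rel (Fin order) 0ℓ
    _~?_   : Decidable _~_
    ~-sym  : Symmetric _~_
    ~-irr  : Irreflexive _≡_ _~_

  Vertex : Set
  Vertex = Fin order

  VertexSet : Set
  VertexSet = Subset order

  neighbourhood : Vertex → VertexSet
  neighbourhood v = tabulate (λ w → does (v ~? w))

  degree : Vertex → ℕ
  degree v = ∣ neighbourhood v ∣

  -- The graph without vertices gets the value 0.
  maxDegree : ℕ
  maxDegree = foldr _⊔_ 0 degree

  IsolateFree : Set
  IsolateFree = ∀ v → degree v ≢ 0

  TotalDominating : VertexSet → Set
  TotalDominating T = ∀ v → ∃ λ w → w ∈ T × v ~ w

  record TotalCoalition (A B : VertexSet) : Set where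
    field
      disjoint     : Empty (A ∩ B)
      ¬dominatingˡ : ¬ TotalDominating A
      ¬dominatingʳ : ¬ TotalDominating B
      ∪-dominating : TotalDominating (A ∪ B)

  -- Partitions are indexed families of classes.  Non-emptiness and
  -- disjointness make the classes distinct, so k is the cardinality.
  record TotalCoalitionPartition (k : ℕ) : Set where
    field
      class     : Vector VertexSet k
      nonempty  : ∀ i → Nonempty (class i)
      disjoint  : ∀ i j → i ≢ j → Empty (class i ∩ class j)
      covers    : ∀ v → ∃ λ i → v ∈ class i
      coalition : ∀ i → ∃ λ j → j ≢ i × TotalCoalition (class i) (class j)

  -- TC(G) = m
  record IsTotalCoalitionNumber (m : ℕ) : Set where
    field
      attained : TotalCoalitionPartition m
      maximal  : ∀ k → TotalCoalitionPartition k → k ≤ m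

bound : ℕ → ℚ
bound Δ with parity Δ
... | 1ℙ = + (Δ ^ 2) / 4 + + Δ / 1 + + 3 / 4
... | 0ℙ = + (Δ ^ 2) / 4 + + Δ / 1 + + 1 / 1

{-# OPTIONS --safe #-}
-- Put Δ = r + b, with r = ⌊Δ/2⌋ and b = ⌈Δ/2⌉, and take r + 1 "hub" classes Aᵢ, each with b
-- private "spoke" classes Bᵢⱼ.  The graph has one component K_{Δ,Δ} for every i, each of whose
-- sides carries every Aₖ with k ≠ i and every Bᵢⱼ exactly once.  So Aᵢ misses precisely the
-- i-th component, which Bᵢⱼ dominates, and Bᵢⱼ misses all the others: Aᵢ and Bᵢⱼ are partners.
-- This gives (r + 1)(b + 1) classes in a Δ-regular graph.  The maximum TC exists constructively
-- because having a total coalition partition of a given size is decidable, by finite search.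
module Submission where

open import Data.Bool.Base using (Bool; true; false)
open import Data.Fin.Base
  using (Fin; zero; suc; _↑ˡ_; _↑ʳ_; join; splitAt; punchIn; punchOut; combine; quotient; remainder)
open import Data.Fin.Properties
  using (_≟_; all?; any?; splitAt-↑ˡ; splitAt-↑ʳ; splitAt-join; join-splitAt; remQuot-combine;
         combine-injective; combine-surjective; punchInᵢ≢i; punchIn-punchOut; injective⇒≤)
open import Data.Fin.Subset using (Subset; _∈_; _∩_; _∪_; ∣_∣; Empty; Nonempty)
open import Data.Fin.Subset.Properties
  using (_∈?_; nonempty?; anySubset?; x∈p∩q⁺; x∈p∩q⁻; x∈p∪q⁺; ∪-comm; ∩-comm)
open import Data.Integer.Base as ℤ using (+_)
open import Data.Integer.Properties using (pos-*)
open import Data.Nat.Base as ℕ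
  using (ℕ; zero; suc; _+_; _*_; _^_; _≤_; _⊔_; z≤n; s≤s; parity; ⌊_/2⌋; ⌈_/2⌉)
open import Data.Nat.Properties
  using (≤-refl; ≤-trans; ≤-reflexive; ≤-antisym; m≤m⊔n; m≤n⊔m; ⊔-lub; m≤n⇒m<n∨m≡n;
         +-identityʳ; *-monoˡ-≤; +-suc; n≡⌊n+n/2⌋; n≡⌈n+n/2⌉; ⌊n/2⌋+⌈n/2⌉≡n)
open import Data.Nat.Tactic.RingSolver using (solve-∀)
open import Data.Parity.Base using (0ℙ; 1ℙ)
open import Data.Parity.Properties using (p+p≡0ℙ; +-homo-+)
open import Data.Product.Base as Product using (∃; _×_; _,_; proj₁; proj₂)
open import Data.Rational.Base as ℚ using (_/_; fromℚᵘ) renaming (_≥_ to _≥ℚ_)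
open import Data.Rational.Properties as ℚ
  using (fromℚᵘ-cong; toℚᵘ-fromℚᵘ; toℚᵘ-injective; toℚᵘ-homo-+; toℚᵘ-cancel-≤)
open import Data.Rational.Unnormalised.Base as ℚᵘ using (mkℚᵘ; *≡*; *≤*)
import Data.Rational.Unnormalised.Properties as ℚᵘ
open import Data.Sum.Base using (_⊎_; inj₁; inj₂; [_,_]′; swap)
open import Data.Sum.Properties using (swap-involutive)
open import Data.Vec.Base using (Vec; []; _∷_; tabulate; lookup)
open import Data.Vec.Functional using (Vector; foldr)
open import Data.Vec.Properties using (lookup∘tabulate; tabulate-cong; []=⇒lookup; lookup⇒[]=)
open import Function.Base using (_∘_; id)
open import Level using (Level)
open import Relation.Binary.PropositionalEquality
open import Relation.Nullary using (Dec; yes; no; does; ¬?; contradiction; _×-dec_; _→-dec_)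
open import Relation.Nullary.Decidable using (map′; dec-true)
open import Relation.Unary using (Pred; Decidable)
open import Defs

private
  variable
    a p : Level
    A : Set a
    m n k : ℕ

-- Bounded search and maxima

-- Descend from the upper bound: if `P` holds at the bound, the bound is the greatest solution; if
-- not, every solution lies strictly below it and the bound drops by one.
greatest : {P : Pred ℕ p} → Decidable P → (∀ k → P k → k ≤ n) → P m →
           ∃ λ k → m ≤ k × P k × (∀ l → P l → l ≤ k)
-- With bound 0 every solution is 0, so the given `m` is already greatest.
greatest {n = zero} {m = m} P? P≤n Pm = m , ≤-refl , Pm , λ l Pl → ≤-trans (P≤n l Pl) z≤n
greatest {n = suc n} {P = P} P? P≤n Pm with P? (suc n)
... | yes Psn = suc n , P≤n _ Pm , Psn , P≤n
... | no ¬Psn = greatest P? P≤n′ Pm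
  where
  P≤n′ : ∀ k → P k → k ≤ n
  P≤n′ k Pk with m≤n⇒m<n∨m≡n (P≤n k Pk)
  ... | inj₁ (s≤s k≤n) = k≤n
  ... | inj₂ refl      = contradiction Pk ¬Psn

-- Exhaustive search passes from `A` to vectors over `A` one coordinate at a time. With `anySubset?`
-- as the search on `A`, it runs through all families of vertex sets.
anyVec? : {A : Set a} → (∀ {P : Pred A a} → Decidable P → Dec (∃ P)) →
          {P : Pred (Vec A n) a} → Decidable P → Dec (∃ P)
anyVec? {n = zero}  any P? = map′ ([] ,_) (λ { ([] , p) → p }) (P? [])
anyVec? {n = suc n} any P? =
  map′ (λ (x , xs , p) → x ∷ xs , p) (λ { (x ∷ xs , p) → x , xs , p })
       (any λ x → anyVec? any λ xs → P? (x ∷ xs))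

-- The argument in `Fin n` excludes the empty vector, whose maximum is the default 0.
foldr-⊔-constant : (f : Vector ℕ n) → Fin n → (∀ i → f i ≡ m) → foldr _⊔_ 0 f ≡ m
foldr-⊔-constant f i f≡m = ≤-antisym (upper f (≤-reflexive ∘ f≡m))
                                     (subst (_≤ _) (f≡m i) (lower f i))
  where
  upper : ∀ {n m} (f : Vector ℕ n) → (∀ i → f i ≤ m) → foldr _⊔_ 0 f ≤ m
  upper {zero}  f f≤m = z≤n
  upper {suc n} f f≤m = ⊔-lub (f≤m zero) (upper (f ∘ suc) (f≤m ∘ suc))

  lower : ∀ {n} (f : Vector ℕ n) i → f i ≤ foldr _⊔_ 0 f
  lower f zero    = m≤m⊔n _ _
  lower f (suc i) = ≤-trans (lower (f ∘ suc) i) (m≤n⊔m _ _)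

-- Sizes of fibres

∣tabulate∣-+ : ∀ m (f : Fin (m + n) → Bool) →
               ∣ tabulate f ∣ ≡ ∣ tabulate (f ∘ (_↑ˡ n)) ∣ + ∣ tabulate (f ∘ (m ↑ʳ_)) ∣
∣tabulate∣-+ zero    f = refl
∣tabulate∣-+ (suc m) f with f zero
... | true  = cong suc (∣tabulate∣-+ m (f ∘ suc))
... | false = ∣tabulate∣-+ m (f ∘ suc)

∣tabulate-true∣ : ∀ n {f : Fin n → Bool} → (∀ i → f i ≡ true) → ∣ tabulate f ∣ ≡ n
∣tabulate-true∣ zero    f≡ = refl
∣tabulate-true∣ (suc n) f≡ rewrite f≡ zero = cong suc (∣tabulate-true∣ n (f≡ ∘ suc))

∣tabulate-false∣ : ∀ n {f : Fin n → Bool} → (∀ i → f i ≡ false) → ∣ tabulate f ∣ ≡ 0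
∣tabulate-false∣ zero    f≡ = refl
∣tabulate-false∣ (suc n) f≡ rewrite f≡ zero = ∣tabulate-false∣ n (f≡ ∘ suc)

quotient-combine : (i : Fin m) (j : Fin n) → quotient n (combine i j) ≡ i
quotient-combine i j = cong proj₁ (remQuot-combine i j)

remainder-combine : (i : Fin m) (j : Fin n) → remainder {m} n (combine i j) ≡ j
remainder-combine i j = cong proj₂ (remQuot-combine i j)

quotient-↑ʳ : ∀ m n (w : Fin (m * n)) → quotient {suc m} n (n ↑ʳ w) ≡ suc (quotient {m} n w)
quotient-↑ʳ m n w rewrite splitAt-↑ʳ n (m * n) w = refl

-- One form for two uses: neighbourhoods in the graph below unfold to fibres of `block`, and the
-- classes are fibres of `colour`.
fibre : (Fin n → Fin m) → Fin m → Subset n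
fibre f y = tabulate (λ x → does (f x ≟ y))

∈-fibre⁺ : ∀ (f : Fin n → Fin m) {x y} → f x ≡ y → x ∈ fibre f y
∈-fibre⁺ f {x} {y} fx≡y = lookup⇒[]= x _ (trans (lookup∘tabulate _ x) (dec-true (f x ≟ y) fx≡y))

∈-fibre⁻ : ∀ (f : Fin n → Fin m) {x y} → x ∈ fibre f y → f x ≡ y
∈-fibre⁻ f {x} {y} x∈
  with f x ≟ y | trans (sym (lookup∘tabulate (λ x → does (f x ≟ y)) x)) ([]=⇒lookup x∈)
... | yes fx≡y | _  = fx≡y
... | no  _    | ()

-- Split `Fin (n + m * n)` into its first `n` elements, which have quotient 0, and the rest, where
-- the quotient is that in `Fin (m * n)` raised by one; then induct on the number of blocks.
∣quotient-fibre∣ : ∀ n (c : Fin m) → ∣ fibre (quotient {m} n) c ∣ ≡ n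
∣quotient-fibre∣ {suc m} n zero = begin
  ∣ fibre (quotient {suc m} n) zero ∣                      ≡⟨ ∣tabulate∣-+ n inFibre ⟩
  ∣ tabulate (inFibre ∘ (_↑ˡ m * n)) ∣ + ∣ tabulate (inFibre ∘ (n ↑ʳ_)) ∣
    ≡⟨ cong₂ _+_
         (∣tabulate-true∣ n (λ j → cong (λ q → does (q ≟ zero)) (quotient-combine {suc m} zero j)))
         (∣tabulate-false∣ (m * n) (λ w → cong (λ q → does (q ≟ zero)) (quotient-↑ʳ m n w))) ⟩
  n + 0                                                    ≡⟨ +-identityʳ n ⟩
  n                                                        ∎
  where
  open ≡-Reasoning
  inFibre : Fin (suc m * n) → Bool
  inFibre w = does (quotient {suc m} n w ≟ zero)
∣quotient-fibre∣ {suc m} n (suc c) = begin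
  ∣ fibre (quotient {suc m} n) (suc c) ∣                   ≡⟨ ∣tabulate∣-+ n inFibre ⟩
  ∣ tabulate (inFibre ∘ (_↑ˡ m * n)) ∣ + ∣ tabulate (inFibre ∘ (n ↑ʳ_)) ∣
    ≡⟨ cong₂ _+_
         (∣tabulate-false∣ n (λ j → cong (λ q → does (q ≟ suc c)) (quotient-combine {suc m} zero j)))
         (cong ∣_∣ (tabulate-cong (λ w → cong (λ q → does (q ≟ suc c)) (quotient-↑ʳ m n w)))) ⟩
  ∣ fibre (quotient {m} n) c ∣                             ≡⟨ ∣quotient-fibre∣ n c ⟩
  n                                                        ∎
  where
  open ≡-Reasoning
  inFibre : Fin (suc m * n) → Bool
  inFibre w = does (quotient {suc m} n w ≟ suc c)

-- Attainment of the total coalition number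

module _ (G : Graph) where
  open Graph G

  totalDominating? : Decidable TotalDominating
  totalDominating? T = all? λ v → any? λ w → (w ∈? T) ×-dec (v ~? w)

  totalCoalition? : ∀ A B → Dec (TotalCoalition A B)
  totalCoalition? A B =
    map′ (λ (d , l , r , u) → record
            { disjoint = d ; ¬dominatingˡ = l ; ¬dominatingʳ = r ; ∪-dominating = u })
         (λ t → let open TotalCoalition t in disjoint , ¬dominatingˡ , ¬dominatingʳ , ∪-dominating)
         (¬? (nonempty? (A ∩ B)) ×-dec ¬? (totalDominating? A) ×-dec ¬? (totalDominating? B)
           ×-dec totalDominating? (A ∪ B))

  totalCoalition-sym : ∀ {A B} → TotalCoalition A B → TotalCoalition B A
  totalCoalition-sym {A} {B} t = record
    { disjoint     = subst Empty (∩-comm A B) disjoint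
    ; ¬dominatingˡ = ¬dominatingʳ
    ; ¬dominatingʳ = ¬dominatingˡ
    ; ∪-dominating = subst TotalDominating (∪-comm A B) ∪-dominating
    } where open TotalCoalition t

  FormsPartition : Vector VertexSet k → Set
  FormsPartition {k} C =
    (∀ i → Nonempty (C i)) × (∀ i j → i ≢ j → Empty (C i ∩ C j)) × (∀ v → ∃ λ i → v ∈ C i) ×
    (∀ i → ∃ λ j → j ≢ i × TotalCoalition (C i) (C j))

  formsPartition? : (C : Vector VertexSet k) → Dec (FormsPartition C)
  formsPartition? C =
    all? (λ i → nonempty? (C i)) ×-dec
    all? (λ i → all? λ j → ¬? (i ≟ j) →-dec ¬? (nonempty? (C i ∩ C j))) ×-dec
    all? (λ v → any? λ i → v ∈? C i) ×-dec
    all? (λ i → any? λ j → ¬? (j ≟ i) ×-dec totalCoalition? (C i) (C j))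

  -- The search yields vectors while a partition stores a function, and tabulating a function then
  -- looking it up returns it only pointwise. The conditions are therefore transported along
  -- pointwise equality.
  formsPartition-resp-≗ : {C D : Vector VertexSet k} → C ≗ D → FormsPartition C → FormsPartition D
  formsPartition-resp-≗ C≗D (nonempty , disjoint , covers , coalition) =
    (λ i → subst Nonempty (C≗D i) (nonempty i)) ,
    (λ i j i≢j → subst₂ (λ X Y → Empty (X ∩ Y)) (C≗D i) (C≗D j) (disjoint i j i≢j)) ,
    (λ v → Product.map₂ (λ {i} → subst (v ∈_) (C≗D i)) (covers v)) ,
    (λ i → Product.map₂ (λ {j} → Product.map₂ (subst₂ TotalCoalition (C≗D i) (C≗D j)))
                        (coalition i))

  totalCoalitionPartition? : Decidable TotalCoalitionPartition
  totalCoalitionPartition? k =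
    map′ (λ (C , n , d , c , t) → record
            { class = lookup C ; nonempty = n ; disjoint = d ; covers = c ; coalition = t })
         (λ Ψ → let open TotalCoalitionPartition Ψ in
            tabulate class ,
            formsPartition-resp-≗ (λ i → sym (lookup∘tabulate class i))
              (nonempty , disjoint , covers , coalition))
         (anyVec? anySubset? (λ C → formsPartition? (lookup C)))

  -- Picking a vertex from each class is injective because the classes are disjoint. This is the
  -- upper bound from which `greatest` descends.
  size≤order : ∀ k → TotalCoalitionPartition k → k ≤ order
  size≤order k Ψ = injective⇒≤ {f = proj₁ ∘ nonempty} injective
    where
    open TotalCoalitionPartition Ψ
    injective : ∀ {i j} → proj₁ (nonempty i) ≡ proj₁ (nonempty j) → i ≡ j
    injective {i} {j} eq with i ≟ j
    ... | yes i≡j = i≡j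
    ... | no  i≢j = contradiction
      (_ , x∈p∩q⁺ (proj₂ (nonempty i) , subst (_∈ class j) (sym eq) (proj₂ (nonempty j))))
      (disjoint i j i≢j)

  totalCoalitionNumber≥ : TotalCoalitionPartition k → ∃ λ TC → k ≤ TC × IsTotalCoalitionNumber TC
  totalCoalitionNumber≥ Ψ =
    Product.map₂ (Product.map₂ λ (attained , maximal) → record
                   { attained = attained ; maximal = maximal })
                 (greatest totalCoalitionPartition? size≤order Ψ)

-- The construction, for r = suc c and b = suc d

module Construction (c d : ℕ) where

  -- Both halves of the degree are successors: `suc c` supplies a second component for `another`,
  -- and `suc d` gives each hub a spoke to pair with.
  Δ hubs spokes blocks : ℕ
  Δ      = suc c + suc d
  hubs   = suc (suc c)
  spokes = suc d
  blocks = hubs + hubs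

  -- The two summands of `Fin (hubs + hubs)` are the two sides of the bipartite components;
  -- forgetting the summand leaves the index of the component, and swapping summands is `otherSide`.
  component : Fin blocks → Fin hubs
  component = [ id , id ]′ ∘ splitAt hubs

  otherSide : Fin blocks → Fin blocks
  otherSide = join hubs hubs ∘ swap ∘ splitAt hubs

  otherSide-involutive : ∀ s → otherSide (otherSide s) ≡ s
  otherSide-involutive s
    rewrite splitAt-join hubs hubs (swap (splitAt hubs s))
          | swap-involutive (splitAt hubs s) = join-splitAt hubs hubs s

  otherSide-irr : ∀ s → otherSide s ≢ s
  otherSide-irr s eq = swap-irr (splitAt hubs s)
    (trans (sym (splitAt-join hubs hubs _)) (cong (splitAt hubs) eq))
    where
    swap-irr : (x : A ⊎ A) → swap x ≢ x
    swap-irr (inj₁ _) ()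
    swap-irr (inj₂ _) ()

  component-otherSide : ∀ s → component (otherSide s) ≡ component s
  component-otherSide s rewrite splitAt-join hubs hubs (swap (splitAt hubs s)) with splitAt hubs s
  ... | inj₁ _ = refl
  ... | inj₂ _ = refl

  component-↑ˡ : ∀ i → component (i ↑ˡ hubs) ≡ i
  component-↑ˡ i = cong [ id , id ]′ (splitAt-↑ˡ hubs i hubs)

  -- A vertex codes a pair: the block it lies in and one of `Δ` positions there, recovered by
  -- `remainder`.
  block : Fin (blocks * Δ) → Fin blocks
  block = quotient Δ

  graph : Graph
  graph = record
    { order = blocks * Δ
    ; _~_   = λ v w → block w ≡ otherSide (block v)
    ; _~?_  = λ v w → block w ≟ otherSide (block v)
    -- Symmetry holds because `otherSide` is an involution, irreflexivity because it has no fixed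
    -- point.
    ; ~-sym = λ {v} w≡ → trans (sym (otherSide-involutive (block v))) (cong otherSide (sym w≡))
    ; ~-irr = λ { {v} refl eq → otherSide-irr (block v) (sym eq) }
    }

  open Graph graph

  regular : ∀ v → degree v ≡ Δ
  regular v = ∣quotient-fibre∣ Δ (otherSide (block v))

  isolateFree : IsolateFree
  isolateFree v deg≡0 with () ← trans (sym deg≡0) (regular v)

  maxDegree≡Δ : maxDegree ≡ Δ
  maxDegree≡Δ = foldr-⊔-constant degree zero regular

  -- The classes and their positions in a component

  Class : Set
  Class = Fin (hubs * suc spokes)

  -- Classes form a table with one row per hub: column `zero` holds the hub itself, column `suc j`
  -- its `j`-th spoke.
  hub : Fin hubs → Class
  hub i = combine {n = suc spokes} i zero

  spoke : Fin hubs → Fin spokes → Class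
  spoke i j = combine i (suc j)

  hub-injective : ∀ {i k} → hub i ≡ hub k → i ≡ k
  hub-injective {i} {k} eq = proj₁ (combine-injective {n = suc spokes} i zero k zero eq)

  spoke-injectiveˡ : ∀ {i j k l} → spoke i j ≡ spoke k l → i ≡ k
  spoke-injectiveˡ {i} {j} {k} {l} eq = proj₁ (combine-injective i (suc j) k (suc l) eq)

  hub≢spoke : ∀ i k j → hub i ≢ spoke k j
  hub≢spoke i k j eq with () ← proj₂ (combine-injective i zero k (suc j) eq)

  data HubOrSpoke : Class → Set where
    isHub   : ∀ i → HubOrSpoke (hub i)
    isSpoke : ∀ i j → HubOrSpoke (spoke i j)

  hubOrSpoke : ∀ y → HubOrSpoke y
  hubOrSpoke y with combine-surjective {hubs} {suc spokes} y
  ... | i , zero  , refl = isHub i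
  ... | i , suc j , refl = isSpoke i j

  -- The class of the vertex in a given position on either side of the i-th component.
  classAt : Fin hubs → Fin Δ → Class
  classAt i q = [ hub ∘ punchIn i , spoke i ]′ (splitAt (suc c) q)

  classAt-hub : ∀ {i k} → i ≢ k → ∃ λ q → classAt i q ≡ hub k
  -- The first `suc c` positions list the hubs with `i` skipped; `punchOut` finds the place of `k`
  -- in that list.
  classAt-hub {i} i≢k = punchOut i≢k ↑ˡ spokes ,
    trans (cong [ hub ∘ punchIn i , spoke i ]′ (splitAt-↑ˡ (suc c) (punchOut i≢k) spokes))
          (cong hub (punchIn-punchOut i≢k))

  classAt-spoke : ∀ i j → ∃ λ q → classAt i q ≡ spoke i j
  classAt-spoke i j = suc c ↑ʳ j ,
    cong [ hub ∘ punchIn i , spoke i ]′ (splitAt-↑ʳ (suc c) spokes j)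

  classAt≢hub : ∀ i q → classAt i q ≢ hub i
  classAt≢hub i q eq with splitAt (suc c) q
  ... | inj₁ k = punchInᵢ≢i i k (hub-injective eq)
  ... | inj₂ j = hub≢spoke i i j (sym eq)

  classAt≢spoke : ∀ {i k} j q → i ≢ k → classAt i q ≢ spoke k j
  classAt≢spoke {i} {k} j q i≢k eq with splitAt (suc c) q
  ... | inj₁ l = hub≢spoke (punchIn i l) k j eq
  ... | inj₂ l = i≢k (spoke-injectiveˡ eq)

  another : (i : Fin hubs) → ∃ λ k → k ≢ i
  another i = punchIn i zero , punchInᵢ≢i i zero

  -- The colouring and its coalitions

  colour : Vertex → Class
  colour v = classAt (component (block v)) (remainder {blocks} Δ v)

  class : Class → VertexSet
  class = fibre colour

  colour-combine : ∀ s q → colour (combine s q) ≡ classAt (component s) q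
  colour-combine s q =
    cong₂ (λ t → classAt (component t)) (quotient-combine s q) (remainder-combine s q)

  -- Both sides of a component carry the same classes in the same positions, so a vertex sees every
  -- class of its own component on the opposite side.
  neighbour : ∀ v q → ∃ λ w → colour w ≡ classAt (component (block v)) q × v ~ w
  neighbour v q = combine (otherSide (block v)) q ,
    trans (colour-combine (otherSide (block v)) q)
          (cong (λ i → classAt i q) (component-otherSide (block v))) ,
    quotient-combine (otherSide (block v)) q

  at : ∀ i q → ∃ λ v → colour v ≡ classAt i q
  at i q = combine (i ↑ˡ hubs) q ,
    trans (colour-combine (i ↑ˡ hubs) q) (cong (λ i → classAt i q) (component-↑ˡ i))

  -- Edges stay inside a component, so a class that dominates a vertex of the `i`-th component must
  -- itself occur there. The test vertex is the one at position `zero` of the left side.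
  dominating⇒everywhere : ∀ {y} → TotalDominating (class y) → ∀ i → ∃ λ q → classAt i q ≡ y
  dominating⇒everywhere {y} dom i with dom (combine (i ↑ˡ hubs) zero)
  ... | w , w∈ , v~w = q , trans (cong (λ i → classAt i q) (sym same)) (∈-fibre⁻ colour w∈)
    where
    q : Fin Δ
    q = remainder {blocks} Δ w
    open ≡-Reasoning
    v : Vertex
    v = combine (i ↑ˡ hubs) zero
    same : component (block w) ≡ i
    same = begin
      component (block w)             ≡⟨ cong component v~w ⟩
      component (otherSide (block v)) ≡⟨ component-otherSide (block v) ⟩
      component (block v)             ≡⟨ cong component (quotient-combine (i ↑ˡ hubs) zero) ⟩
      component (i ↑ˡ hubs)           ≡⟨ component-↑ˡ i ⟩
      i                               ∎

  class-disjoint : ∀ x y → x ≢ y → Empty (class x ∩ class y)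
  class-disjoint x y x≢y (v , v∈) with x∈p∩q⁻ (class x) (class y) v∈
  ... | v∈x , v∈y = x≢y (trans (sym (∈-fibre⁻ colour v∈x)) (∈-fibre⁻ colour v∈y))

  hub-spoke : ∀ i j → TotalCoalition (class (hub i)) (class (spoke i j))
  hub-spoke i j = record
    { disjoint     = class-disjoint (hub i) (spoke i j) (hub≢spoke i i j)
    ; ¬dominatingˡ = λ dom → let q , eq = dominating⇒everywhere dom i in classAt≢hub i q eq
    ; ¬dominatingʳ = λ dom → let k , k≢i = another i ; q , eq = dominating⇒everywhere dom k
                             in classAt≢spoke j q k≢i eq
    ; ∪-dominating = dominating
    }
    where
    dominating : TotalDominating (class (hub i) ∪ class (spoke i j))
    -- The spoke serves the vertices of component `i`, the hub those of all the others.
    dominating v with component (block v) ≟ i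
    ... | yes k≡i = let q , at-q = classAt-spoke i j ; w , w-colour , v~w = neighbour v q
                    in w , x∈p∪q⁺ (inj₂ (∈-fibre⁺ colour
                             (trans w-colour (trans (cong (λ k → classAt k q) k≡i) at-q)))) , v~w
    ... | no  k≢i = let q , at-q = classAt-hub k≢i ; w , w-colour , v~w = neighbour v q
                    in w , x∈p∪q⁺ (inj₁ (∈-fibre⁺ colour (trans w-colour at-q))) , v~w

  class-nonempty : ∀ y → Nonempty (class y)
  class-nonempty y with hubOrSpoke y
  ... | isHub i     = let k , k≢i = another i ; q , at-q = classAt-hub k≢i ; v , eq = at k q
                      in v , ∈-fibre⁺ colour (trans eq at-q)
  ... | isSpoke i j = let q , at-q = classAt-spoke i j ; v , eq = at i q
                      in v , ∈-fibre⁺ colour (trans eq at-q)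

  class-coalition : ∀ y → ∃ λ z → z ≢ y × TotalCoalition (class y) (class z)
  class-coalition y with hubOrSpoke y
  ... | isHub i     = spoke i zero , hub≢spoke i i zero ∘ sym , hub-spoke i zero
  ... | isSpoke i j = hub i , hub≢spoke i i j , totalCoalition-sym graph (hub-spoke i j)

  partition : TotalCoalitionPartition (hubs * suc spokes)
  partition = record
    { class     = class
    ; nonempty  = class-nonempty
    ; disjoint  = class-disjoint
    ; covers    = λ v → colour v , ∈-fibre⁺ colour refl
    ; coalition = class-coalition
    }

-- The value of the bound

-- The operation `/` reduces to lowest terms, so sums are computed on unnormalised fractions and
-- carried back through the injective homomorphism `toℚᵘ`.
fromℚᵘ-homo-+ : ∀ p q → fromℚᵘ p ℚ.+ fromℚᵘ q ≡ fromℚᵘ (p ℚᵘ.+ q)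
fromℚᵘ-homo-+ p q = toℚᵘ-injective (begin
  ℚ.toℚᵘ (fromℚᵘ p ℚ.+ fromℚᵘ q)              ≈⟨ toℚᵘ-homo-+ (fromℚᵘ p) (fromℚᵘ q) ⟩
  ℚ.toℚᵘ (fromℚᵘ p) ℚᵘ.+ ℚ.toℚᵘ (fromℚᵘ q)   ≈⟨ ℚᵘ.+-cong (toℚᵘ-fromℚᵘ p) (toℚᵘ-fromℚᵘ q) ⟩
  p ℚᵘ.+ q                                    ≈⟨ toℚᵘ-fromℚᵘ (p ℚᵘ.+ q) ⟨
  ℚ.toℚᵘ (fromℚᵘ (p ℚᵘ.+ q))                  ∎)
  where open import Relation.Binary.Reasoning.Setoid ℚᵘ.≃-setoid

/-homo-+ : ∀ k l d e → + k / suc d ℚ.+ + l / suc e ≡ + (k * suc e + l * suc d) / (suc d * suc e)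
/-homo-+ k l d e = trans (fromℚᵘ-homo-+ (mkℚᵘ (+ k) d) (mkℚᵘ (+ l) e))
  (cong (λ i → i / (suc d * suc e)) (sym (cong₂ ℤ._+_ (pos-* k (suc e)) (pos-* l (suc d)))))

/-cross : ∀ k l d e → k * suc e ≡ l * suc d → + k / suc d ≡ + l / suc e
/-cross k l d e eq = fromℚᵘ-cong {mkℚᵘ (+ k) d} {mkℚᵘ (+ l) e}
  (*≡* (trans (sym (pos-* k (suc e))) (trans (cong +_ eq) (pos-* l (suc d)))))

/1-mono-≤ : k ≤ n → + k / 1 ℚ.≤ + n / 1
/1-mono-≤ {k} {n} k≤n = toℚᵘ-cancel-≤ (begin
  ℚ.toℚᵘ (+ k / 1)  ≃⟨ toℚᵘ-fromℚᵘ (mkℚᵘ (+ k) 0) ⟩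
  mkℚᵘ (+ k) 0      ≤⟨ *≤* (subst₂ ℤ._≤_ (pos-* k 1) (pos-* n 1) (ℤ.+≤+ (*-monoˡ-≤ 1 k≤n))) ⟩
  mkℚᵘ (+ n) 0      ≃⟨ toℚᵘ-fromℚᵘ (mkℚᵘ (+ n) 0) ⟨
  ℚ.toℚᵘ (+ n / 1)  ∎)
  where open ℚᵘ.≤-Reasoning

parity-double : ∀ m → parity (m + m) ≡ 0ℙ
parity-double m = trans (+-homo-+ m m) (p+p≡0ℙ (parity m))

parity-1+double : ∀ m → parity (suc (m + m)) ≡ 1ℙ
parity-1+double zero    = refl
parity-1+double (suc m) rewrite +-suc m m = parity-1+double m

bound-even : ∀ m → bound (m + m) ≡ + (suc m * suc m) / 1
bound-even m with parity (m + m) | parity-double m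
-- Abstracting the parity and replacing it by its known value lets `bound` reduce to its even
-- branch.
... | _ | refl = begin
  + s / 4 ℚ.+ + (m + m) / 1 ℚ.+ + 1 / 1       ≡⟨ cong (ℚ._+ + 1 / 1) (/-homo-+ s (m + m) 3 0) ⟩
  + (s * 1 + (m + m) * 4) / 4 ℚ.+ + 1 / 1     ≡⟨ /-homo-+ (s * 1 + (m + m) * 4) 1 3 0 ⟩
  + ((s * 1 + (m + m) * 4) * 1 + 1 * 4) / 4
    ≡⟨ /-cross ((s * 1 + (m + m) * 4) * 1 + 1 * 4) (suc m * suc m) 3 0 (arith m) ⟩
  + (suc m * suc m) / 1                       ∎
  where
  open ≡-Reasoning
  s = (m + m) ^ 2
  arith : ∀ m → (((m + m) * ((m + m) * 1) * 1 + (m + m) * 4) * 1 + 1 * 4) * 1 ≡ suc m * suc m * 4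
  arith = solve-∀

bound-odd : ∀ m → bound (suc (m + m)) ≡ + (suc m * suc (suc m)) / 1
bound-odd m with parity (suc (m + m)) | parity-1+double m
... | _ | refl = begin
  + s / 4 ℚ.+ + t / 1 ℚ.+ + 3 / 4            ≡⟨ cong (ℚ._+ + 3 / 4) (/-homo-+ s t 3 0) ⟩
  + (s * 1 + t * 4) / 4 ℚ.+ + 3 / 4          ≡⟨ /-homo-+ (s * 1 + t * 4) 3 3 3 ⟩
  -- `/-homo-+` multiplies denominators without cancelling, hence 16, which `/-cross` receives as
  -- the successor of 15.
  + ((s * 1 + t * 4) * 4 + 3 * 4) / 16
    ≡⟨ /-cross ((s * 1 + t * 4) * 4 + 3 * 4) (suc m * suc (suc m)) 15 0 (arith m) ⟩
  + (suc m * suc (suc m)) / 1                ∎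
  where
  open ≡-Reasoning
  t = suc (m + m)
  s = t ^ 2
  arith : ∀ m → ((suc (m + m) * (suc (m + m) * 1) * 1 + suc (m + m) * 4) * 4 + 3 * 4) * 1
                ≡ suc m * suc (suc m) * 16
  arith = solve-∀

even⊎odd : ∀ n → (∃ λ m → n ≡ m + m) ⊎ (∃ λ m → n ≡ suc (m + m))
even⊎odd zero    = inj₁ (0 , refl)
even⊎odd (suc n) with even⊎odd n
... | inj₁ (m , refl) = inj₂ (m , refl)
... | inj₂ (m , refl) = inj₁ (suc m , cong suc (sym (+-suc m m)))

-- In both parities the bound is exactly (r + 1)(b + 1), the number of classes constructed.
bound≡ : ∀ n → bound n ≡ + (suc ⌊ n /2⌋ * suc ⌈ n /2⌉) / 1
bound≡ n with even⊎odd n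
... | inj₁ (m , refl) rewrite sym (n≡⌊n+n/2⌋ m) | sym (n≡⌈n+n/2⌉ m) = bound-even m
-- Adding one turns the floor of the half into the old ceiling, and the ceiling into the successor
-- of the old floor, so the rewrites of the even case serve again.
... | inj₂ (m , refl) rewrite sym (n≡⌊n+n/2⌋ m) | sym (n≡⌈n+n/2⌉ m) = bound-odd m

theorem3p3 : ∀ (Δ : ℕ) → 3 ≤ Δ →
    ∃ λ (G : Graph) → Graph.IsolateFree G × Graph.maxDegree G ≡ Δ ×
    ∃ λ (TC : ℕ) → Graph.IsTotalCoalitionNumber G TC × (+ TC / 1) ≥ℚ bound Δ
theorem3p3 (suc (suc n)) (s≤s (s≤s _)) =
  let TC , size≤TC , isTC = totalCoalitionNumber≥ graph partition
  in graph , isolateFree , trans maxDegree≡Δ Δ≡ ,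
     TC , isTC , subst (ℚ._≤ + TC / 1) (sym (bound≡ (suc (suc n)))) (/1-mono-≤ size≤TC)
  where
  -- The halves of `suc (suc n)` reduce to the successors of these two numbers, so `partition` has
  -- by computation the size appearing in `bound≡`.
  open Construction ⌊ n /2⌋ ⌈ n /2⌉
  Δ≡ : Δ ≡ suc (suc n)
  Δ≡ = ⌊n/2⌋+⌈n/2⌉≡n (suc (suc n))
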